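{- Let $B_{\mathrm{unl}}(x,y)=\sum_{i,j\ge0}b_{i,j}x^iy^j$, where $b_{i,j}$ is the number of isomorphism classes of bicoloured graphs with $i$ vertices in the first colour class and $j$ in the second, and let $T_{\mathrm{unl}}(x,y)=\sum_{i,j\ge0}\tau_{i,j}x^iy^j$, where $\tau_{i,j}$ is the number of isomorphism classes of tangles with $i$ vertices in the first colour class and $j$ in the second. Then \[T_{\mathrm{unl}}(x,y)=1-x-y-B_{\mathrm{unl}}(x,y)^{ -1}.\]
   Context: A bicoloured graph is a triple $G=(V_1,V_2,E)$ with $V_1,V_2$ disjoint finite sets (ordered colour classes) and $E\subseteq V_1\times V_2$; isomorphisms are graph isomorphisms mapping $V_1$ to $V_1$ and $V_2$ to $V_2$. For a vertex $u$ let $N(u)$ be its set of neighbours. $G$ is called a tangle if $|V_1|\ge2$, $|V_2|\ge2$, the graph on $V_2$ joining $a,b$ whenever neither of $N(a),N(b)$ contains the other is connected, and the graph on $V_1$ defined by the same rule is connected. (Equivalently, viewing $G$ as the poset on $V_1\cup V_2$ with $u<w$ iff $u\in V_1,w\in V_2$, $(u,w)\in E$, the whole poset is a single tangle, i.e. a component of $(2+2)$-connectedness with top $V_2$ and bottom $V_1$.) -}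

module Defs where

open import Data.Bool using (Bool; T)
import Data.Bool.Properties as Bool
open import Data.Fin using (Fin; toℕ; finToFun; funToFin)
import Data.Fin as Fin using (zero; suc)
import Data.Fin.Properties as Fin
open import Data.Fin.Permutation as Perm using (Permutation′; permutation; _⟨$⟩ʳ_; _⟨$⟩ˡ_)
open import Data.Integer using (ℤ; +_; _-_; _*_; 0ℤ; 1ℤ)
import Data.Integer.Properties as ℤ
open import Algebra.Properties.CommutativeMonoid.Sum ℤ.+-0-commutativeMonoid using (sum⁺-syntax)
open import Data.List using (List; []; _∷_; length; lookup; tabulate; allFin; deduplicate)
open import Data.List.Membership.Propositional.Properties using (∈-allFin; ∈-lookup)
import Data.List.Membership.Setoid as SetoidMembership
import Data.List.Membership.Setoid.Properties as Membership
open import Data.List.Membership.Propositional using (_∈_)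
open import Data.List.Relation.Unary.All as All using ()
open import Data.List.Relation.Unary.AllPairs using ([]; _∷_)
open import Data.List.Relation.Unary.Any using (here; there)
open import Data.List.Relation.Unary.Enumerates.Setoid using (IsEnumeration)
open import Data.List.Relation.Unary.Enumerates.Setoid.Properties using (deduplicate⁺; lookup-surjective)
open import Data.List.Relation.Unary.Unique.DecSetoid.Properties using (deduplicate-!)
open import Data.List.Relation.Unary.Unique.Setoid using (Unique)
open import Data.Nat using (ℕ; _∸_; _^_; _≤_; _≤?_)
open import Data.Product using (Σ; ∃; _×_; _,_; proj₁; proj₂)
open import Data.Sum using (_⊎_; inj₁; inj₂)
open import Function using (_∘_; Bijection; Inverse)
open import Level using (0ℓ)
open import Relation.Binary using (Rel; Setoid; DecSetoid; Decidable)
open import Relation.Binary.Construct.Closure.ReflexiveTransitive using (Star; ε; _◅_; _◅◅_; gmap)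
import Relation.Binary.Construct.On as On
open import Relation.Binary.PropositionalEquality as ≡ using (_≡_; refl; sym; trans; cong; cong₂; subst; subst₂)
open import Relation.Nullary using (Dec; yes; no; ¬_; ¬?; contradiction)
open import Relation.Nullary.Decidable using (map′; _×-dec_; _⊎-dec_; _→-dec_)
open import Relation.Unary using (Pred; _⊆_)

-- Only the cardinalities of the colour classes matter up to isomorphism, so
-- the classes are taken to be Fin m and Fin n; being separate types, they are
-- disjoint.
record BicolouredGraph (m n : ℕ) : Set where
  constructor graph
  field
    edge : Fin m → Fin n → Bool

  N₁ : Fin m → Pred (Fin n) 0ℓ
  N₁ u w = T (edge u w)

  N₂ : Fin n → Pred (Fin m) 0ℓ
  N₂ w u = T (edge u w)

open BicolouredGraph public

record _≅_ {m n : ℕ} (G H : BicolouredGraph m n) : Set where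
  constructor iso
  field
    φ₁ : Permutation′ m
    φ₂ : Permutation′ n
    preserves : ∀ u w → edge G u w ≡ edge H (φ₁ ⟨$⟩ʳ u) (φ₂ ⟨$⟩ʳ w)

open _≅_ public

Incomparable : {V W : Set} → (V → Pred W 0ℓ) → Rel V 0ℓ
Incomparable N a b = ¬ (N a ⊆ N b) × ¬ (N b ⊆ N a)

-- Star R a b is the type of R-walks from a to b; R is symmetric where this is
-- used.
Connected : {V : Set} → Rel V 0ℓ → Set
Connected R = ∀ a b → Star R a b

record IsTangle {m n : ℕ} (G : BicolouredGraph m n) : Set where
  field
    2≤m  : 2 ≤ m
    2≤n  : 2 ≤ n
    con₂ : Connected (Incomparable (N₂ G))
    con₁ : Connected (Incomparable (N₁ G))

open IsTangle public

≅-refl : ∀ {m n} {G : BicolouredGraph m n} → G ≅ G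
≅-refl = iso Perm.id Perm.id λ _ _ → refl

≅-sym : ∀ {m n} {G H : BicolouredGraph m n} → G ≅ H → H ≅ G
≅-sym {H = H} (iso φ ψ p) = iso (Perm.flip φ) (Perm.flip ψ) λ u w →
  sym (trans (p (φ ⟨$⟩ˡ u) (ψ ⟨$⟩ˡ w)) (cong₂ (edge H) (Perm.inverseʳ φ) (Perm.inverseʳ ψ)))

≅-trans : ∀ {m n} {G H K : BicolouredGraph m n} → G ≅ H → H ≅ K → G ≅ K
≅-trans (iso φ ψ p) (iso φ′ ψ′ p′) = iso (φ Perm.∘ₚ φ′) (ψ Perm.∘ₚ ψ′) λ u w →
  trans (p u w) (p′ (φ ⟨$⟩ʳ u) (ψ ⟨$⟩ʳ w))

graphSetoid : ℕ → ℕ → Setoid 0ℓ 0ℓ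
graphSetoid m n = record
  { Carrier       = BicolouredGraph m n
  ; _≈_           = _≅_
  ; isEquivalence = record { refl = ≅-refl ; sym = ≅-sym ; trans = ≅-trans }
  }

tangleSetoid : ℕ → ℕ → Setoid 0ℓ 0ℓ
tangleSetoid m n = On.setoid {B = Σ (BicolouredGraph m n) IsTangle} (graphSetoid m n) proj₁

-- A setoid plays the role of the quotient of its carrier, so this says that
-- there are exactly k equivalence classes.
HasSize : Setoid 0ℓ 0ℓ → ℕ → Set
HasSize S k = Bijection (≡.setoid (Fin k)) S

lookup-injective : (S : Setoid 0ℓ 0ℓ) → ∀ {xs} → Unique S xs →
                   ∀ {i j} → Setoid._≈_ S (lookup xs i) (lookup xs j) → i ≡ j
lookup-injective S (p ∷ ps) {Fin.zero}  {Fin.zero}  e = refl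
lookup-injective S (p ∷ ps) {Fin.zero}  {Fin.suc j} e = contradiction e (All.lookup p (∈-lookup j))
lookup-injective S (p ∷ ps) {Fin.suc i} {Fin.zero}  e = contradiction (Setoid.sym S e) (All.lookup p (∈-lookup i))
lookup-injective S (p ∷ ps) {Fin.suc i} {Fin.suc j} e = cong Fin.suc (lookup-injective S ps e)

countClasses : (S? : DecSetoid 0ℓ 0ℓ) → let S = DecSetoid.setoid S? in
               ∀ xs → IsEnumeration S xs → ∃ (HasSize S)
countClasses S? xs enum = length reps , record
  { to        = lookup reps
  ; cong      = λ { refl → DecSetoid.refl S? }
  ; bijective = lookup-injective S (deduplicate-! S? xs) , lookup-surjective S (deduplicate⁺ S? enum)
  }
  where
  S    = DecSetoid.setoid S?
  reps = deduplicate (DecSetoid._≟_ S?) xs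

-- Warshall's algorithm: Reach R vs a b says that there is an R-walk from a to b
-- all of whose intermediate vertices are in vs.
module _ {n : ℕ} (R : Rel (Fin n) 0ℓ) (R? : Decidable R) where

  Reach : List (Fin n) → Rel (Fin n) 0ℓ
  Reach []       a b = a ≡ b ⊎ R a b
  Reach (v ∷ vs) a b = Reach vs a b ⊎ (Reach vs a v × Reach vs v b)

  reach? : ∀ vs → Decidable (Reach vs)
  reach? []       a b = (a Fin.≟ b) ⊎-dec R? a b
  reach? (v ∷ vs) a b = reach? vs a b ⊎-dec (reach? vs a v ×-dec reach? vs v b)

  reach⇒star : ∀ vs {a b} → Reach vs a b → Star R a b
  reach⇒star []       (inj₁ refl)    = ε
  reach⇒star []       (inj₂ r)       = r ◅ ε
  reach⇒star (v ∷ vs) (inj₁ p)       = reach⇒star vs p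
  reach⇒star (v ∷ vs) (inj₂ (p , q)) = reach⇒star vs p ◅◅ reach⇒star vs q

  reach-base : ∀ vs {a b} → a ≡ b ⊎ R a b → Reach vs a b
  reach-base []       p = p
  reach-base (v ∷ vs) p = inj₁ (reach-base vs p)

  reach-join : ∀ vs {a w b} → w ∈ vs → Reach vs a w → Reach vs w b → Reach vs a b
  reach-join (v ∷ vs) (here refl) p q = inj₂ (toHead p , fromHead q)
    where
    toHead : ∀ {a} → Reach (v ∷ vs) a v → Reach vs a v
    toHead (inj₁ p)       = p
    toHead (inj₂ (p , _)) = p
    fromHead : ∀ {b} → Reach (v ∷ vs) v b → Reach vs v b
    fromHead (inj₁ p)       = p
    fromHead (inj₂ (_ , p)) = p
  reach-join (v ∷ vs) (there i) (inj₁ p)        (inj₁ q)        = inj₁ (reach-join vs i p q)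
  reach-join (v ∷ vs) (there i) (inj₁ p)        (inj₂ (q , q′)) = inj₂ (reach-join vs i p q , q′)
  reach-join (v ∷ vs) (there i) (inj₂ (p , p′)) (inj₁ q)        = inj₂ (p , reach-join vs i p′ q)
  reach-join (v ∷ vs) (there i) (inj₂ (p , _))  (inj₂ (_ , q′)) = inj₂ (p , q′)

  star⇒reach : ∀ {a b} → Star R a b → Reach (allFin n) a b
  star⇒reach ε        = reach-base (allFin n) (inj₁ refl)
  star⇒reach (r ◅ rs) = reach-join (allFin n) (∈-allFin _) (reach-base (allFin n) (inj₂ r)) (star⇒reach rs)

  connected? : Dec (Connected R)
  connected? = Fin.all? λ a → Fin.all? λ b →
    map′ (reach⇒star (allFin n)) star⇒reach (reach? (allFin n) a b)

incomparable? : ∀ {k l} {N : Fin k → Pred (Fin l) 0ℓ} → Decidable N → Decidable (Incomparable N)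
incomparable? {N = N} N? a b = ¬? (a ⊆? b) ×-dec ¬? (b ⊆? a)
  where
  _⊆?_ : ∀ a b → Dec (N a ⊆ N b)
  a ⊆? b = map′ (λ f {x} → f x) (λ f x → f {x}) (Fin.all? λ x → N? a x →-dec N? b x)

isTangle? : ∀ {m n} (G : BicolouredGraph m n) → Dec (IsTangle G)
isTangle? {m} {n} G =
  map′ (λ (a , b , c , d) → record { 2≤m = a ; 2≤n = b ; con₂ = c ; con₁ = d })
       (λ t → 2≤m t , 2≤n t , con₂ t , con₁ t)
       (2 ≤? m ×-dec 2 ≤? n
         ×-dec connected? _ (incomparable? λ w u → Bool.T? (edge G u w))
         ×-dec connected? _ (incomparable? λ u w → Bool.T? (edge G u w)))

IsTangle-resp-≅ : ∀ {m n} {G H : BicolouredGraph m n} → G ≅ H → IsTangle G → IsTangle H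
IsTangle-resp-≅ {G = G} {H} (iso φ ψ p) t = record
  { 2≤m  = 2≤m t
  ; 2≤n  = 2≤n t
  ; con₂ = λ a b → subst₂ (Star _) (Perm.inverseʳ ψ) (Perm.inverseʳ ψ)
             (gmap (ψ ⟨$⟩ʳ_) (λ (x , y) → x ∘ back₂ , y ∘ back₂) (con₂ t (ψ ⟨$⟩ˡ a) (ψ ⟨$⟩ˡ b)))
  ; con₁ = λ a b → subst₂ (Star _) (Perm.inverseʳ φ) (Perm.inverseʳ φ)
             (gmap (φ ⟨$⟩ʳ_) (λ (x , y) → x ∘ back₁ , y ∘ back₁) (con₁ t (φ ⟨$⟩ˡ a) (φ ⟨$⟩ˡ b)))
  }
  where
  back₂ : ∀ {a b} → N₂ H (ψ ⟨$⟩ʳ a) ⊆ N₂ H (ψ ⟨$⟩ʳ b) → N₂ G a ⊆ N₂ G b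
  back₂ {a} {b} s {u} e = subst T (sym (p u b)) (s (subst T (p u a) e))
  back₁ : ∀ {a b} → N₁ H (φ ⟨$⟩ʳ a) ⊆ N₁ H (φ ⟨$⟩ʳ b) → N₁ G a ⊆ N₁ G b
  back₁ {a} {b} s {w} e = subst T (sym (p b w)) (s (subst T (p a w) e))

_≅?_ : ∀ {m n} → Decidable (_≅_ {m} {n})
_≅?_ {m} {n} G H = map′ to from
  (Fin.any? λ f → Fin.any? λ f′ → Fin.any? λ g → Fin.any? λ g′ → good? f f′ g g′)
  where
  Good : Fin (m ^ m) → Fin (m ^ m) → Fin (n ^ n) → Fin (n ^ n) → Set
  Good f f′ g g′ =
      (∀ u → finToFun {m} {m} f (finToFun f′ u) ≡ u) × (∀ u → finToFun {m} {m} f′ (finToFun f u) ≡ u)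
    × (∀ w → finToFun {n} {n} g (finToFun g′ w) ≡ w) × (∀ w → finToFun {n} {n} g′ (finToFun g w) ≡ w)
    × (∀ u w → edge G u w ≡ edge H (finToFun f u) (finToFun g w))
  good? : ∀ f f′ g g′ → Dec (Good f f′ g g′)
  good? f f′ g g′ =
            Fin.all? (λ _ → _ Fin.≟ _) ×-dec Fin.all? (λ _ → _ Fin.≟ _)
      ×-dec Fin.all? (λ _ → _ Fin.≟ _) ×-dec Fin.all? (λ _ → _ Fin.≟ _)
      ×-dec Fin.all? (λ _ → Fin.all? λ _ → _ Bool.≟ _)
  to : (∃ λ f → ∃ λ f′ → ∃ λ g → ∃ λ g′ → Good f f′ g g′) → G ≅ H
  to (f , f′ , g , g′ , a , b , c , d , e) =
    iso (permutation (finToFun f) (finToFun f′) a b) (permutation (finToFun g) (finToFun g′) c d) e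
  code-inv : ∀ {k} (f g : Fin k → Fin k) → (∀ {x} → f (g x) ≡ x) →
             ∀ x → finToFun (funToFin f) (finToFun (funToFin g) x) ≡ x
  code-inv f g inv x = trans (Fin.finToFun-funToFin f _) (trans (cong f (Fin.finToFun-funToFin g x)) inv)
  from : G ≅ H → ∃ λ f → ∃ λ f′ → ∃ λ g → ∃ λ g′ → Good f f′ g g′
  from (iso φ ψ p) =
      funToFin (φ ⟨$⟩ʳ_) , funToFin (φ ⟨$⟩ˡ_) , funToFin (ψ ⟨$⟩ʳ_) , funToFin (ψ ⟨$⟩ˡ_)
    , code-inv _ _ (Perm.inverseʳ φ) , code-inv _ _ (Perm.inverseˡ φ)
    , code-inv _ _ (Perm.inverseʳ ψ) , code-inv _ _ (Perm.inverseˡ ψ)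
    , λ u w → trans (p u w) (sym (cong₂ (edge H) (Fin.finToFun-funToFin (φ ⟨$⟩ʳ_) u)
                                                 (Fin.finToFun-funToFin (ψ ⟨$⟩ʳ_) w)))

graphDecSetoid : ℕ → ℕ → DecSetoid 0ℓ 0ℓ
graphDecSetoid m n = record
  { isDecEquivalence = record { isEquivalence = Setoid.isEquivalence (graphSetoid m n) ; _≟_ = _≅?_ } }

tangleDecSetoid : ℕ → ℕ → DecSetoid 0ℓ 0ℓ
tangleDecSetoid m n = record
  { isDecEquivalence = record
      { isEquivalence = Setoid.isEquivalence (tangleSetoid m n) ; _≟_ = λ (G , _) (H , _) → G ≅? H } }

decode : ∀ {m n} → Fin ((2 ^ n) ^ m) → BicolouredGraph m n
decode c = graph λ u w → Inverse.to Fin.2↔Bool (finToFun (finToFun c u) w)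

encode : ∀ {m n} → BicolouredGraph m n → Fin ((2 ^ n) ^ m)
encode G = funToFin λ u → funToFin λ w → Inverse.from Fin.2↔Bool (edge G u w)

decode-encode : ∀ {m n} (G : BicolouredGraph m n) → G ≅ decode (encode G)
decode-encode {m} {n} G = iso Perm.id Perm.id λ u w → sym (trans
  (cong (Inverse.to Fin.2↔Bool) (trans
    (cong (λ c → finToFun c w) (Fin.finToFun-funToFin {m} row u))
    (Fin.finToFun-funToFin {n} (λ w → Inverse.from Fin.2↔Bool (edge G u w)) w)))
  (Inverse.inverseˡ Fin.2↔Bool refl))
  where
  row : Fin m → Fin (2 ^ n)
  row u = funToFin λ w → Inverse.from Fin.2↔Bool (edge G u w)

allGraphs : ∀ m n → List (BicolouredGraph m n)
allGraphs m n = tabulate decode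

allGraphs-enumerates : ∀ m n → IsEnumeration (graphSetoid m n) (allGraphs m n)
allGraphs-enumerates m n G =
  Membership.∈-resp-≈ (graphSetoid m n) (≅-sym (decode-encode G))
    (Membership.∈-tabulate⁺ (graphSetoid m n) (encode G))

keepTangles : ∀ {m n} → List (BicolouredGraph m n) → List (Σ (BicolouredGraph m n) IsTangle)
keepTangles []       = []
keepTangles (G ∷ Gs) with isTangle? G
... | yes t = (G , t) ∷ keepTangles Gs
... | no  _ = keepTangles Gs

∈-keepTangles : ∀ {m n} (H : Σ (BicolouredGraph m n) IsTangle) Gs →
                SetoidMembership._∈_ (graphSetoid m n) (proj₁ H) Gs →
                SetoidMembership._∈_ (tangleSetoid m n) H (keepTangles Gs)
∈-keepTangles H (G ∷ Gs) i with isTangle? G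
∈-keepTangles H (G ∷ Gs) (here p)  | yes t = here p
∈-keepTangles H (G ∷ Gs) (there i) | yes t = there (∈-keepTangles H Gs i)
∈-keepTangles H (G ∷ Gs) (here p)  | no ¬t = contradiction (IsTangle-resp-≅ p (proj₂ H)) ¬t
∈-keepTangles H (G ∷ Gs) (there i) | no ¬t = ∈-keepTangles H Gs i

countGraphs : ∀ m n → ∃ (HasSize (graphSetoid m n))
countGraphs m n = countClasses (graphDecSetoid m n) (allGraphs m n) (allGraphs-enumerates m n)

countTangles : ∀ m n → ∃ (HasSize (tangleSetoid m n))
countTangles m n = countClasses (tangleDecSetoid m n) (keepTangles (allGraphs m n))
  λ H → ∈-keepTangles H (allGraphs m n) (allGraphs-enumerates m n (proj₁ H))

b : ℕ → ℕ → ℕ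
b i j = proj₁ (countGraphs i j)

τ : ℕ → ℕ → ℕ
τ i j = proj₁ (countTangles i j)

-- F i j is the coefficient of xⁱyʲ.
Series : Set
Series = ℕ → ℕ → ℤ

infix  4 _≈ˢ_
infixl 6 _-ˢ_
infixl 7 _*ˢ_

_≈ˢ_ : Rel Series 0ℓ
F ≈ˢ G = ∀ i j → F i j ≡ G i j

_-ˢ_ : Series → Series → Series
(F -ˢ G) i j = F i j - G i j

_*ˢ_ : Series → Series → Series
(F *ˢ G) i j = ∑[ k ≤ i ] ∑[ l ≤ j ] (F (toℕ k) (toℕ l) * G (i ∸ toℕ k) (j ∸ toℕ l))

1ˢ : Series
1ˢ 0 0 = 1ℤ
1ˢ _ _ = 0ℤ

xˢ : Series
xˢ 1 0 = 1ℤ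
xˢ _ _ = 0ℤ

yˢ : Series
yˢ 0 1 = 1ℤ
yˢ _ _ = 0ℤ

Bunl : Series
Bunl i j = + b i j

Tunl : Series
Tunl i j = + τ i j

{-# OPTIONS --safe #-}
-- Read a bicoloured graph as a bipartite tournament: the arc between u ∈ V₁ and w ∈ V₂ goes from w
-- to u if they are adjacent and from u to w otherwise.  A set of vertices that no arc leaves splits
-- the graph as an ordered sum E ⊞ F, in which V₁ E is completely joined to V₂ F and V₁ F not at all
-- to V₂ E.  Call the nonempty strongly connected graphs blocks.  Every nonempty graph is block ⊞ rest,
-- and both parts are unique up to isomorphism: an isomorphism of two such sums maps one block onto the
-- other, unless it permutes one-vertex blocks of the same colour, and these are twins.
--
-- Two vertices of the same colour are incomparable iff they lie on a common 4-cycle of the tournament;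
-- hence the blocks with at least two vertices are the tangles, and B = 1 + (x + y + T) B.
module Submission where

open import Defs
open import Algebra.Definitions _≈ˢ_ using (Invertible)
open import Algebra.Properties.AbelianGroup using (∙-cancelʳ)
open import Data.Bool using (Bool; T; false; not; true)
import Data.Bool.Properties as Bool
open import Data.Fin using (Fin; fromℕ<; suc; toℕ; zero)
open import Data.Fin.Permutation as Perm using (↔⇒≡; _⟨$⟩ʳ_)
import Data.Fin.Properties as Fin
open import Data.Integer as ℤ using (+_; 0ℤ; 1ℤ; ℤ)
import Data.Integer.Properties as ℤ
open import Data.Integer.Tactic.RingSolver using (solve-∀)
open import Data.List using (allFin)
open import Data.Nat as ℕ using (_+_; _<_; _∸_; _≤_; suc; s≤s; zero; z≤n; ℕ)
open import Data.Nat.Induction using (<-wellFounded)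
import Data.Nat.Properties as ℕ
open import Data.Product as Product using (_,_; _×_; proj₁; proj₂; Σ; Σ-syntax; ∃; ∃₂)
open import Data.Product.Function.Dependent.Propositional using (Σ-↔)
open import Data.Product.Relation.Binary.Pointwise.NonDependent using (_×ₛ_)
open import Data.Sum as Sum using (_⊎_; inj₁; inj₂)
open import Data.Sum.Algebra using (⊎-assoc; ⊎-comm)
open import Data.Sum.Function.Propositional using (_⊎-↔_)
open import Data.Sum.Properties using (inj₁-injective; inj₂-injective; swap-involutive)
open import Function
  using (_on_; _∘_; _↔_; Bijection; Congruent; Equivalence; id; Injective; Inverse; mk↔ₛ′;
         StrictlySurjective)
open import Function.Consequences.Setoid using (strictlySurjective⇒surjective)
import Function.Construct.Composition as Composition
open import Function.Construct.Composition using (_↔-∘_)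
open import Function.Construct.Identity using (↔-id)
import Function.Construct.Symmetry as Symmetry
open import Function.Construct.Symmetry using (↔-sym)
open import Function.Properties.Bijection using (Bijection⇒Inverse)
open import Function.Properties.Inverse using (Inverse⇒Bijection)
open import Function.Related.Propositional using (module EquationalReasoning)
open import Induction.WellFounded using (Acc; acc)
open import Level using (0ℓ) renaming (suc to lsuc)
open import Relation.Binary using (_Respects_; Decidable; Rel; Setoid; Transitive)
open import Relation.Binary.Construct.Closure.ReflexiveTransitive as Star using (_◅_; _◅◅_; ε; Star)
import Relation.Binary.Construct.On as On
open import Relation.Binary.PropositionalEquality
  using (_≡_; _≢_; cong; cong₂; module ≡-Reasoning; refl; setoid; subst; subst₂; sym; trans)
import Relation.Binary.Reasoning.Setoid as SetoidReasoning
open import Relation.Nullary using (¬?; ¬_; contradiction; Dec; no; yes)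
open import Relation.Nullary.Decidable using (_×-dec_; dec-true; decidable-stable; map′)
open import Relation.Unary as Unary using (_⊆_; Pred)
open import Algebra.Properties.CommutativeMonoid.Sum ℕ.+-0-commutativeMonoid
  using () renaming (sum to sumℕ)
open import Algebra.Properties.CommutativeMonoid.Sum ℤ.+-0-commutativeMonoid
  using (∑-distrib-+; sum; sum-cong-≗; sum-permute; sum-replicate-zero; sum-syntax; sum⁺-syntax)

open Inverse using (from; strictlyInverseˡ; strictlyInverseʳ; to)

private variable
  A A′ C C′ S S′ X : Set
  k k′ l l′ m m′ n n′ : ℕ

-- Without η, Agda infers E and F from E ⊞ F.
record Bigraph : Set₁ where
  no-eta-equality
  field
    V₁ V₂ : Set
    adj   : V₁ → V₂ → Bool

open Bigraph

private variable
  E E′ F F′ K : Bigraph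

⟦_⟧ : BicolouredGraph m n → Bigraph
V₁  (⟦_⟧ {m} G)     = Fin m
V₂  (⟦_⟧ {n = n} G) = Fin n
adj ⟦ G ⟧           = edge G

Vertex : Bigraph → Set
Vertex E = V₁ E ⊎ V₂ E

infix 4 _≃_

record _≃_ (E F : Bigraph) : Set where
  constructor mk≃
  field
    iso₁     : V₁ E ↔ V₁ F
    iso₂     : V₂ E ↔ V₂ F
    respects : ∀ u w → adj E u w ≡ adj F (to iso₁ u) (to iso₂ w)

open _≃_

≃-refl : E ≃ E
≃-refl = mk≃ (↔-id _) (↔-id _) λ _ _ → refl

≃-sym : E ≃ F → F ≃ E
≃-sym {F = F} (mk≃ f g r) = mk≃ (↔-sym f) (↔-sym g) λ u w →
  sym (trans (r _ _) (cong₂ (adj F) (strictlyInverseˡ f u) (strictlyInverseˡ g w)))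

≃-trans : E ≃ F → F ≃ K → E ≃ K
≃-trans (mk≃ f g r) (mk≃ f′ g′ r′) = mk≃ (f′ ↔-∘ f) (g′ ↔-∘ g) λ u w → trans (r u w) (r′ _ _)

≃-setoid : Setoid (lsuc 0ℓ) 0ℓ
≃-setoid = record
  { Carrier       = Bigraph
  ; _≈_           = _≃_
  ; isEquivalence = record { refl = ≃-refl ; sym = ≃-sym ; trans = ≃-trans }
  }

private module ≃-Reasoning = SetoidReasoning ≃-setoid

respects-from₁ : (i : E ≃ F) → ∀ u w → adj E (from (iso₁ i) u) w ≡ adj F u (to (iso₂ i) w)
respects-from₁ {F = F} i u w =
  trans (respects i _ w) (cong (λ u → adj F u _) (strictlyInverseˡ (iso₁ i) u))

respects-from₂ : (i : E ≃ F) → ∀ u w → adj E u (from (iso₂ i) w) ≡ adj F (to (iso₁ i) u) w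
respects-from₂ {F = F} i u w =
  trans (respects i u _) (cong (adj F _) (strictlyInverseˡ (iso₂ i) w))

≃⇒≅ : {G H : BicolouredGraph m n} → ⟦ G ⟧ ≃ ⟦ H ⟧ → G ≅ H
≃⇒≅ (mk≃ f g r) = iso f g r

≅⇒≃ : {G H : BicolouredGraph m n} → G ≅ H → ⟦ G ⟧ ≃ ⟦ H ⟧
≅⇒≃ (iso f g r) = mk≃ f g r

relabel : (E : Bigraph) → V₁ E ↔ Fin m → V₂ E ↔ Fin n → BicolouredGraph m n
relabel E f g = graph λ u w → adj E (from f u) (from g w)

relabel-≃ : (f : V₁ E ↔ Fin m) (g : V₂ E ↔ Fin n) → ⟦ relabel E f g ⟧ ≃ E
relabel-≃ f g = mk≃ (↔-sym f) (↔-sym g) λ _ _ → refl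

-- Ordered sums

infixr 5 _⊞_

_⊞_ : Bigraph → Bigraph → Bigraph
V₁ (E ⊞ F) = V₁ E ⊎ V₁ F
V₂ (E ⊞ F) = V₂ E ⊎ V₂ F
adj (E ⊞ F) (inj₁ u) (inj₁ w) = adj E u w
adj (E ⊞ F) (inj₁ u) (inj₂ w) = true
adj (E ⊞ F) (inj₂ u) (inj₁ w) = false
adj (E ⊞ F) (inj₂ u) (inj₂ w) = adj F u w

⊞-cong : E ≃ E′ → F ≃ F′ → E ⊞ F ≃ E′ ⊞ F′
⊞-cong (mk≃ f g r) (mk≃ f′ g′ r′) = mk≃ (f ⊎-↔ f′) (g ⊎-↔ g′) λ where
  (inj₁ u) (inj₁ w) → r u w
  (inj₁ u) (inj₂ w) → refl
  (inj₂ u) (inj₁ w) → refl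
  (inj₂ u) (inj₂ w) → r′ u w

⊞-assoc : ∀ E F K → (E ⊞ F) ⊞ K ≃ E ⊞ (F ⊞ K)
⊞-assoc E F K = mk≃ (⊎-assoc 0ℓ _ _ _) (⊎-assoc 0ℓ _ _ _) λ where
  (inj₁ (inj₁ u)) (inj₁ (inj₁ w)) → refl
  (inj₁ (inj₁ u)) (inj₁ (inj₂ w)) → refl
  (inj₁ (inj₁ u)) (inj₂ w)        → refl
  (inj₁ (inj₂ u)) (inj₁ (inj₁ w)) → refl
  (inj₁ (inj₂ u)) (inj₁ (inj₂ w)) → refl
  (inj₁ (inj₂ u)) (inj₂ w)        → refl
  (inj₂ u)        (inj₁ (inj₁ w)) → refl
  (inj₂ u)        (inj₁ (inj₂ w)) → refl
  (inj₂ u)        (inj₂ w)        → refl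

⊞-identityʳ : (E : Bigraph) (∅ : BicolouredGraph 0 0) → E ⊞ ⟦ ∅ ⟧ ≃ E
⊞-identityʳ E ∅ = mk≃ ⊎Fin0↔ ⊎Fin0↔ λ { (inj₁ u) (inj₁ w) → refl }
  where
  ⊎Fin0↔ : (A ⊎ Fin 0) ↔ A
  ⊎Fin0↔ = mk↔ₛ′ (λ { (inj₁ x) → x ; (inj₂ ()) }) inj₁
                 (λ _ → refl) (λ { (inj₁ x) → refl ; (inj₂ ()) })

infixr 5 _⊕_

_⊕_ : BicolouredGraph k l → BicolouredGraph k′ l′ → BicolouredGraph (k + k′) (l + l′)
G ⊕ H = relabel (⟦ G ⟧ ⊞ ⟦ H ⟧) (↔-sym Fin.+↔⊎) (↔-sym Fin.+↔⊎)

⊕≃⊞ : (G : BicolouredGraph k l) (H : BicolouredGraph k′ l′) → ⟦ G ⊕ H ⟧ ≃ ⟦ G ⟧ ⊞ ⟦ H ⟧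
⊕≃⊞ G H = relabel-≃ (↔-sym Fin.+↔⊎) (↔-sym Fin.+↔⊎)

-- Arcs and blocks

data Arc (E : Bigraph) : Rel (Vertex E) 0ℓ where
  nonadjacent : ∀ {u w} → adj E u w ≡ false → Arc E (inj₁ u) (inj₂ w)
  adjacent    : ∀ {u w} → adj E u w ≡ true  → Arc E (inj₂ w) (inj₁ u)

Arc? : (G : BicolouredGraph m n) → Decidable (Arc ⟦ G ⟧)
Arc? G (inj₁ u) (inj₂ w) = map′ nonadjacent (λ { (nonadjacent p) → p }) (edge G u w Bool.≟ false)
Arc? G (inj₂ w) (inj₁ u) = map′ adjacent    (λ { (adjacent p) → p })    (edge G u w Bool.≟ true)
Arc? G (inj₁ _) (inj₁ _) = no λ ()
Arc? G (inj₂ _) (inj₂ _) = no λ ()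

Arc-map : (f : V₁ E → V₁ F) (g : V₂ E → V₂ F) → (∀ u w → adj E u w ≡ adj F (f u) (g w)) →
          ∀ {v w} → Arc E v w → Arc F (Sum.map f g v) (Sum.map f g w)
Arc-map f g r (nonadjacent p) = nonadjacent (trans (sym (r _ _)) p)
Arc-map f g r (adjacent p)    = adjacent (trans (sym (r _ _)) p)

StronglyConnected : Bigraph → Set
StronglyConnected E = Connected (Arc E)

record IsBlock (E : Bigraph) : Set where
  field
    vertex : Vertex E
    strong : StronglyConnected E

open IsBlock

empty-¬block : {G : BicolouredGraph 0 0} → ¬ IsBlock ⟦ G ⟧
empty-¬block record { vertex = inj₁ () }
empty-¬block record { vertex = inj₂ () }

infix 8 _ᵒ

-- Exchanging the colours reverses all arcs and the order of summands, and so does complementing; the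
-- two together preserve both.
_ᵒ : Bigraph → Bigraph
V₁  (E ᵒ) = V₂ E
V₂  (E ᵒ) = V₁ E
adj (E ᵒ) w u = not (adj E u w)

ᵒ-cong : E ≃ F → E ᵒ ≃ F ᵒ
ᵒ-cong (mk≃ f g r) = mk≃ g f λ w u → cong not (r u w)

ᵒ-injective : E ᵒ ≃ F ᵒ → E ≃ F
ᵒ-injective (mk≃ g f r) = mk≃ f g λ u w → Bool.not-injective (r w u)

ᵒ-⊞ : ∀ E F → (E ⊞ F) ᵒ ≃ E ᵒ ⊞ F ᵒ
ᵒ-⊞ E F = mk≃ (↔-id _) (↔-id _) λ where
  (inj₁ w) (inj₁ u) → refl
  (inj₁ w) (inj₂ u) → refl
  (inj₂ w) (inj₁ u) → refl
  (inj₂ w) (inj₂ u) → refl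

ᵒ-Arc : ∀ {v w} → Arc E v w → Arc (E ᵒ) (Sum.swap v) (Sum.swap w)
ᵒ-Arc (nonadjacent p) = adjacent (cong not p)
ᵒ-Arc (adjacent p)    = nonadjacent (cong not p)

ᵒ-strong : StronglyConnected E → StronglyConnected (E ᵒ)
ᵒ-strong {E} con v w = subst₂ (Star (Arc (E ᵒ))) (swap-involutive v) (swap-involutive w)
  (Star.gmap Sum.swap ᵒ-Arc (con (Sum.swap v) (Sum.swap w)))

-- Cancellation of the first block

from-eq : (f : A ↔ C) {x : A} {y : C} → to f x ≡ y → from f y ≡ x
from-eq f refl = strictlyInverseʳ f _

restrict : (f : S ↔ S′) (ι : A → S) (ι′ : A′ → S′) → Injective _≡_ _≡_ ι → Injective _≡_ _≡_ ι′ →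
           (∀ a → ∃ λ a′ → to f (ι a) ≡ ι′ a′) → (∀ a′ → ∃ λ a → from f (ι′ a′) ≡ ι a) →
           Σ[ g ∈ A ↔ A′ ] ∀ a → to f (ι a) ≡ ι′ (to g a)
restrict f ι ι′ ι-injective ι′-injective forth back =
  mk↔ₛ′ (proj₁ ∘ forth) (proj₁ ∘ back)
    (λ a′ → ι′-injective (trans (sym (proj₂ (forth _))) (from-eq (↔-sym f) (proj₂ (back a′)))))
    (λ a  → ι-injective  (trans (sym (proj₂ (back _)))  (from-eq f (proj₂ (forth a)))))
  , proj₂ ∘ forth

IsInj₁ : Pred (A ⊎ C) 0ℓ
IsInj₁ s = ∃ λ a → s ≡ inj₁ a

isInj₁? : (s : A ⊎ C) → Dec (IsInj₁ s)
isInj₁? (inj₁ a) = yes (a , refl)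
isInj₁? (inj₂ c) = no λ ()

⊎-↔-split : (f : (A ⊎ C) ↔ (A′ ⊎ C′)) →
            (∀ a → IsInj₁ (to f (inj₁ a))) → (∀ a′ → IsInj₁ (from f (inj₁ a′))) →
            Σ[ g ∈ A ↔ A′ ] Σ[ h ∈ C ↔ C′ ] ∀ s → to f s ≡ Sum.map (to g) (to h) s
⊎-↔-split f forth back =
  let g , f∘inj₁ = restrict f inj₁ inj₁ inj₁-injective inj₁-injective forth back
      h , f∘inj₂ = restrict f inj₂ inj₂ inj₂-injective inj₂-injective
                     (preserves-inj₂ f back) (preserves-inj₂ (↔-sym f) forth)
  in  g , h , Sum.[ f∘inj₁ , f∘inj₂ ]
  where
  preserves-inj₂ : (f : (A ⊎ C) ↔ (A′ ⊎ C′)) → (∀ a′ → IsInj₁ (from f (inj₁ a′))) →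
                   ∀ c → ∃ λ c′ → to f (inj₂ c) ≡ inj₂ c′
  preserves-inj₂ f back c with to f (inj₂ c) in fc
  ... | inj₂ c′ = c′ , refl
  ... | inj₁ a′ with _ , f⁻¹a′ ← back a′ with () ← trans (sym f⁻¹a′) (from-eq f fc)

InFirst : Pred ((A ⊎ C) ⊎ (A′ ⊎ C′)) 0ℓ
InFirst = Sum.[ IsInj₁ , IsInj₁ ]

InFirst-closed : InFirst Respects Arc (E ⊞ F)
InFirst-closed (nonadjacent {inj₁ u} {inj₁ w} _) _ = w , refl
InFirst-closed (adjacent    {inj₁ u} {w}      _) _ = u , refl
InFirst-closed (adjacent    {inj₂ u} {inj₁ w} ()) _

⊞-adjacent : ∀ E F {u} w → ¬ IsInj₁ w → adj (E ⊞ F) (inj₁ u) w ≡ true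
⊞-adjacent E F (inj₁ w) ¬first = contradiction (w , refl) ¬first
⊞-adjacent E F (inj₂ w) ¬first = refl

⊞-nonadjacent : ∀ E F u {w} → ¬ IsInj₁ u → adj (E ⊞ F) u (inj₁ w) ≡ false
⊞-nonadjacent E F (inj₁ u) ¬first = contradiction (u , refl) ¬first
⊞-nonadjacent E F (inj₂ u) ¬first = refl

image : E ⊞ F ≃ E′ ⊞ F′ → Vertex E → Vertex (E′ ⊞ F′)
image i = Sum.map (to (iso₁ i) ∘ inj₁) (to (iso₂ i) ∘ inj₁)

Aligned : E ⊞ F ≃ E′ ⊞ F′ → Set
Aligned i = (∀ v → InFirst (image i v)) × (∀ v′ → InFirst (image (≃-sym i) v′))

aligned⇒≃ : (i : E ⊞ F ≃ E′ ⊞ F′) → Aligned i → E ≃ E′ × F ≃ F′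
aligned⇒≃ {E} {F} {E′} {F′} (mk≃ f g r) (forth , back) =
  let f₁ , f₂ , f-split = ⊎-↔-split f (forth ∘ inj₁) (back ∘ inj₁)
      g₁ , g₂ , g-split = ⊎-↔-split g (forth ∘ inj₂) (back ∘ inj₂)
      r-split : ∀ u w → adj (E ⊞ F) u w ≡
                        adj (E′ ⊞ F′) (Sum.map (to f₁) (to f₂) u) (Sum.map (to g₁) (to g₂) w)
      r-split u w = trans (r u w) (cong₂ (adj (E′ ⊞ F′)) (f-split u) (g-split w))
  in  mk≃ f₁ g₁ (λ u w → r-split (inj₁ u) (inj₁ w)) , mk≃ f₂ g₂ (λ u w → r-split (inj₂ u) (inj₂ w))

closed⇒Star-closed : ∀ {ℓ p} {R : Rel A ℓ} {P : Pred A p} → P Respects R → P Respects (Star R)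
closed⇒Star-closed {P = P} closed = Star.fold (λ v w → P v → P w) (λ r f → f ∘ closed r) id

overlap⇒aligned : StronglyConnected E → StronglyConnected E′ → (i : E ⊞ F ≃ E′ ⊞ F′) →
                  ∀ v → InFirst (image i v) → Aligned i
overlap⇒aligned con con′ i v v↦first =
  let v′ , v′↦first = preimage v v↦first
  in  spread con i v v↦first , spread con′ (≃-sym i) v′ v′↦first
  where
  spread : StronglyConnected E → (i : E ⊞ F ≃ E′ ⊞ F′) → ∀ v → InFirst (image i v) →
           ∀ w → InFirst (image i w)
  spread con i v v↦first w = closed⇒Star-closed {P = InFirst ∘ image i}
    (λ a → InFirst-closed (Arc-map _ _ (λ u w → respects i (inj₁ u) (inj₁ w)) a)) (con v w) v↦first
  preimage : ∀ v → InFirst (image i v) → ∃ λ v′ → InFirst (image (≃-sym i) v′)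
  preimage (inj₁ u) (u′ , fu≡u′) = inj₁ u′ , u , from-eq (iso₁ i) fu≡u′
  preimage (inj₂ w) (w′ , gw≡w′) = inj₂ w′ , w , from-eq (iso₂ i) gw≡w′

-- If E and E′ were moved off each other, then u and w would be both adjacent and nonadjacent.
opposite⇒aligned : StronglyConnected E → StronglyConnected E′ → (i : E ⊞ F ≃ E′ ⊞ F′) →
                   V₁ E → V₂ E′ → Aligned i
opposite⇒aligned {E} {E′} {F} {F′} con con′ i u w
  with isInj₁? (to (iso₁ i) (inj₁ u)) | isInj₁? (from (iso₂ i) (inj₁ w))
... | yes first | _         = overlap⇒aligned con con′ i (inj₁ u) first
... | no _      | yes first = Product.swap (overlap⇒aligned con′ con (≃-sym i) (inj₂ w) first)
... | no ¬first | no ¬first′ = contradiction true≡false λ ()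
  where
  open ≡-Reasoning
  true≡false : true ≡ false
  true≡false = begin
    true
      ≡⟨ ⊞-adjacent E F (from (iso₂ i) (inj₁ w)) ¬first′ ⟨
    adj (E ⊞ F) (inj₁ u) (from (iso₂ i) (inj₁ w))
      ≡⟨ respects-from₂ i (inj₁ u) (inj₁ w) ⟩
    adj (E′ ⊞ F′) (to (iso₁ i) (inj₁ u)) (inj₁ w)
      ≡⟨ ⊞-nonadjacent E′ F′ (to (iso₁ i) (inj₁ u)) ¬first ⟩
    false ∎

transpose-source : (x y : Fin n) → Perm.transpose x y ⟨$⟩ʳ x ≡ y
transpose-source x y rewrite dec-true (x Fin.≟ x) refl = refl

transpose-invariant : (f : Fin n → X) (x y : Fin n) → f x ≡ f y →
                      ∀ z → f z ≡ f (Perm.transpose x y ⟨$⟩ʳ z)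
transpose-invariant f x y fx≡fy z with z Fin.≟ x
... | yes refl = fx≡fy
... | no _ with z Fin.≟ y
...   | yes refl = sym fx≡fy
...   | no _     = refl

twins⇒automorphism : V₁ E ↔ Fin n → ∀ u v → (∀ w → adj E u w ≡ adj E v w) →
                     Σ[ σ ∈ E ≃ E ] to (iso₁ σ) u ≡ v
twins⇒automorphism {E} e u v twins =
  mk≃ (↔-sym e ↔-∘ (Perm.transpose (to e u) (to e v) ↔-∘ e)) (↔-id _) transposition-respects
  , trans (cong (from e) (transpose-source (to e u) (to e v))) (strictlyInverseʳ e v)
  where
  open ≡-Reasoning
  adj-from-to : ∀ x w → adj E (from e (to e x)) w ≡ adj E x w
  adj-from-to x w = cong (λ x → adj E x w) (strictlyInverseʳ e x)
  transposition-respects : ∀ x w → adj E x w ≡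
                           adj E (from e (Perm.transpose (to e u) (to e v) ⟨$⟩ʳ to e x)) w
  transposition-respects x w = trans (sym (adj-from-to x w))
    (transpose-invariant (λ z → adj E (from e z) w) (to e u) (to e v) (begin
      adj E (from e (to e u)) w  ≡⟨ adj-from-to u w ⟩
      adj E u w                  ≡⟨ twins w ⟩
      adj E v w                  ≡⟨ adj-from-to v w ⟨
      adj E (from e (to e v)) w  ∎) (to e x))

-- Here the blocks may be moved off each other; exchanging the twins u and v first prevents this.
one-class-cancel : StronglyConnected E → StronglyConnected E′ → ¬ V₂ E → ¬ V₂ E′ → V₁ E → V₁ E′ →
                   V₁ (E ⊞ F) ↔ Fin n → E ⊞ F ≃ E′ ⊞ F′ → E ≃ E′ × F ≃ F′
one-class-cancel {E} {E′} {F} {F′ = F′} con con′ ¬V₂ ¬V₂′ u u′ e i =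
  let σ , σu≡v = twins⇒automorphism e (inj₁ u) v twins
      j        = ≃-trans σ i
      ju≡u′    = trans (cong (to (iso₁ i)) σu≡v) (strictlyInverseˡ (iso₁ i) (inj₁ u′))
  in  aligned⇒≃ j (overlap⇒aligned con con′ j (inj₁ u) (u′ , ju≡u′))
  where
  open ≡-Reasoning
  v : V₁ (E ⊞ F)
  v = from (iso₁ i) (inj₁ u′)
  twins : ∀ w → adj (E ⊞ F) (inj₁ u) w ≡ adj (E ⊞ F) v w
  twins w = begin
    adj (E ⊞ F) (inj₁ u) w                   ≡⟨ ⊞-adjacent E F w (¬V₂ ∘ proj₁) ⟩
    true                                     ≡⟨ ⊞-adjacent E′ F′ (to (iso₂ i) w) (¬V₂′ ∘ proj₁) ⟨
    adj (E′ ⊞ F′) (inj₁ u′) (to (iso₂ i) w)  ≡⟨ respects-from₁ i (inj₁ u′) w ⟨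
    adj (E ⊞ F) v w                          ∎

⊞-cancel : {G : BicolouredGraph k l} {G′ : BicolouredGraph m n}
           {H : BicolouredGraph k′ l′} {H′ : BicolouredGraph m′ n′} →
           IsBlock ⟦ G ⟧ → IsBlock ⟦ G′ ⟧ → ⟦ G ⟧ ⊞ ⟦ H ⟧ ≃ ⟦ G′ ⟧ ⊞ ⟦ H′ ⟧ →
           ⟦ G ⟧ ≃ ⟦ G′ ⟧ × ⟦ H ⟧ ≃ ⟦ H′ ⟧
⊞-cancel {suc k} {l} {m} {suc n} β β′ i =
  aligned⇒≃ i (opposite⇒aligned (strong β) (strong β′) i zero zero)
⊞-cancel {k} {suc l} {suc m} {n} β β′ i =
  aligned⇒≃ i (Product.swap (opposite⇒aligned (strong β′) (strong β) (≃-sym i) zero zero))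
⊞-cancel {suc k} {zero} {suc m} {zero} β β′ i =
  one-class-cancel (strong β) (strong β′) (λ ()) (λ ()) zero zero (↔-sym Fin.+↔⊎) i
⊞-cancel {zero} {suc l} {zero} {suc n} β β′ i = Product.map ᵒ-injective ᵒ-injective
  (one-class-cancel (ᵒ-strong (strong β)) (ᵒ-strong (strong β′)) (λ ()) (λ ()) zero zero
    (↔-sym Fin.+↔⊎) (≃-trans (≃-sym (ᵒ-⊞ _ _)) (≃-trans (ᵒ-cong i) (ᵒ-⊞ _ _))))
⊞-cancel {zero} {zero} β β′ i = contradiction β empty-¬block
⊞-cancel {m = zero} {zero} β β′ i = contradiction β′ empty-¬block

-- Existence of a first block

module _ {R : Rel A 0ℓ} (e : A ↔ Fin n) (R? : Decidable R) where

  star? : Decidable (Star R)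
  star? x y = map′
    (subst₂ (Star R) (strictlyInverseʳ e x) (strictlyInverseʳ e y)
      ∘ Star.gmap (from e) id ∘ reach⇒star R′ R′? (allFin n))
    (star⇒reach R′ R′? ∘ Star.gmap (to e)
      (subst₂ R (sym (strictlyInverseʳ e _)) (sym (strictlyInverseʳ e _))))
    (reach? R′ R′? (allFin n) (to e x) (to e y))
    where
    R′ : Rel (Fin n) 0ℓ
    R′ = R on from e
    R′? : Decidable R′
    R′? = On.decidable (from e) R R?

  connected⊎unreachable : Connected R ⊎ ∃₂ λ x y → ¬ Star R x y
  connected⊎unreachable with Fin.any? (λ a → Fin.any? λ c → ¬? (star? (from e a) (from e c)))
  ... | yes (_ , _ , ¬path) = inj₂ (_ , _ , ¬path)
  ... | no all-reachable    = inj₁ λ x y → decidable-stable (star? x y) λ ¬path →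
    all-reachable (to e x , to e y ,
      ¬path ∘ subst₂ (Star R) (strictlyInverseʳ e x) (strictlyInverseʳ e y))

record Partition (P : Pred (Fin m) 0ℓ) : Set where
  field
    {#in #out} : ℕ
    merge      : (Fin #in ⊎ Fin #out) ↔ Fin m
    merge-in   : ∀ x → P (to merge (inj₁ x))
    merge-out  : ∀ y → ¬ P (to merge (inj₂ y))

  in-inhabited : ∀ {z} → P z → Fin #in
  in-inhabited {z} Pz with from merge z in eq
  ... | inj₁ x = x
  ... | inj₂ y = contradiction (subst P (sym (from-eq (↔-sym merge) eq)) Pz) (merge-out y)

  out-inhabited : ∀ {z} → ¬ P z → Fin #out
  out-inhabited {z} ¬Pz with from merge z in eq
  ... | inj₁ x = contradiction (subst P (from-eq (↔-sym merge) eq) (merge-in x)) ¬Pz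
  ... | inj₂ y = y

open Partition

suc⊎↔ : (Fin k ⊎ Fin l) ↔ Fin m → (Fin (suc k) ⊎ Fin l) ↔ Fin (suc m)
suc⊎↔ {k} {l} {m} f =
  (Fin (suc k) ⊎ Fin l)      ↔⟨ Fin.+↔⊎ {1} ⊎-↔ ↔-id _ ⟩
  ((Fin 1 ⊎ Fin k) ⊎ Fin l)  ↔⟨ ⊎-assoc 0ℓ _ _ _ ⟩
  (Fin 1 ⊎ (Fin k ⊎ Fin l))  ↔⟨ ↔-id _ ⊎-↔ f ⟩
  (Fin 1 ⊎ Fin m)            ↔⟨ Fin.+↔⊎ ⟨
  Fin (suc m)                ∎
  where open EquationalReasoning

⊎suc↔ : (Fin k ⊎ Fin l) ↔ Fin m → (Fin k ⊎ Fin (suc l)) ↔ Fin (suc m)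
⊎suc↔ f = suc⊎↔ (f ↔-∘ ⊎-comm _ _) ↔-∘ ⊎-comm _ _

partition : {P : Pred (Fin m) 0ℓ} → Unary.Decidable P → Partition P
partition {zero}  P? = record { merge = ↔-sym (Fin.+↔⊎ {0}) ; merge-in = λ () ; merge-out = λ () }
partition {suc m} P? with P? zero | partition (P? ∘ suc)
... | yes p | rest = record
  { merge     = suc⊎↔ (merge rest)
  ; merge-in  = λ { zero → p ; (suc x) → merge-in rest x }
  ; merge-out = merge-out rest
  }
... | no ¬p | rest = record
  { merge     = ⊎suc↔ (merge rest)
  ; merge-in  = merge-in rest
  ; merge-out = λ { zero → ¬p ; (suc y) → merge-out rest y }
  }

record Split (G : BicolouredGraph m n) : Set where
  field
    {k₁ l₁ k₂ l₂} : ℕ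
    {inner}       : BicolouredGraph k₁ l₁
    {outer}       : BicolouredGraph k₂ l₂
    inner⊞outer   : ⟦ inner ⟧ ⊞ ⟦ outer ⟧ ≃ ⟦ G ⟧
    inner-vertex  : Vertex ⟦ inner ⟧
    outer-vertex  : Vertex ⟦ outer ⟧

closed⇒split : (G : BicolouredGraph m n) {P : Pred (Vertex ⟦ G ⟧) 0ℓ} → Unary.Decidable P →
               P Respects Arc ⟦ G ⟧ → ∀ {v w} → P v → ¬ P w → Split G
closed⇒split G {P} P? closed Pv ¬Pw = record
  { inner        = graph λ u w → edge G (to (merge p₁) (inj₁ u)) (to (merge p₂) (inj₁ w))
  ; outer        = graph λ u w → edge G (to (merge p₁) (inj₂ u)) (to (merge p₂) (inj₂ w))
  ; inner⊞outer  = mk≃ (merge p₁) (merge p₂) λ where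
      (inj₁ u) (inj₁ w) → refl
      (inj₁ u) (inj₂ w) → sym (Bool.¬-not λ ¬uw →
        merge-out p₂ w (closed (nonadjacent ¬uw) (merge-in p₁ u)))
      (inj₂ u) (inj₁ w) → sym (Bool.¬-not λ uw →
        merge-out p₁ u (closed (adjacent uw) (merge-in p₂ w)))
      (inj₂ u) (inj₂ w) → refl
  ; inner-vertex = inside _ Pv
  ; outer-vertex = outside _ ¬Pw
  }
  where
  p₁ : Partition (P ∘ inj₁)
  p₁ = partition (P? ∘ inj₁)
  p₂ : Partition (P ∘ inj₂)
  p₂ = partition (P? ∘ inj₂)
  inside : ∀ v → P v → Fin (#in p₁) ⊎ Fin (#in p₂)
  inside (inj₁ u) = inj₁ ∘ in-inhabited p₁
  inside (inj₂ w) = inj₂ ∘ in-inhabited p₂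
  outside : ∀ v → ¬ P v → Fin (#out p₁) ⊎ Fin (#out p₂)
  outside (inj₁ u) = inj₁ ∘ out-inhabited p₁
  outside (inj₂ w) = inj₂ ∘ out-inhabited p₂

block⊎split : (G : BicolouredGraph m n) → Vertex ⟦ G ⟧ → IsBlock ⟦ G ⟧ ⊎ Split G
block⊎split G v₀ with connected⊎unreachable (↔-sym Fin.+↔⊎) (Arc? G)
... | inj₁ con              = inj₁ record { vertex = v₀ ; strong = con }
... | inj₂ (v , _ , ¬path) = inj₂
  (closed⇒split G (star? (↔-sym Fin.+↔⊎) (Arc? G) v) (λ a path → path ◅◅ a ◅ ε) ε ¬path)

⊎↔⇒+≡ : (Fin k ⊎ Fin l) ↔ Fin m → k + l ≡ m
⊎↔⇒+≡ f = ↔⇒≡ (f ↔-∘ Fin.+↔⊎)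

inhabited⇒<+ : ∀ m → Fin k → m < m + k
inhabited⇒<+ {suc k} m _ = ℕ.m<m+n m ℕ.z<s

inhabited⇒+<+ : k + k′ ≡ m → l + l′ ≡ n → Fin k′ ⊎ Fin l′ → k + l < m + n
inhabited⇒+<+ {k} {l = l} refl refl (inj₁ u) = ℕ.+-mono-<-≤ (inhabited⇒<+ k u) (ℕ.m≤m+n l _)
inhabited⇒+<+ {k} {l = l} refl refl (inj₂ w) = ℕ.+-mono-≤-< (ℕ.m≤m+n k _) (inhabited⇒<+ l w)

inner-smaller : {G : BicolouredGraph m n} (s : Split G) → let open Split s in k₁ + l₁ < m + n
inner-smaller s = inhabited⇒+<+ (⊎↔⇒+≡ (iso₁ inner⊞outer)) (⊎↔⇒+≡ (iso₂ inner⊞outer)) outer-vertex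
  where open Split s

record Decomposition (G : BicolouredGraph m n) : Set where
  field
    {k₁ l₁ k₂ l₂} : ℕ
    {first}       : BicolouredGraph k₁ l₁
    {rest}        : BicolouredGraph k₂ l₂
    first-block   : IsBlock ⟦ first ⟧
    first⊞rest    : ⟦ first ⟧ ⊞ ⟦ rest ⟧ ≃ ⟦ G ⟧

split⇒decomposition : {G : BicolouredGraph m n} (s : Split G) →
                      Decomposition (Split.inner s) → Decomposition G
split⇒decomposition {G = G} s d = record
  { first-block = first-block
  ; first⊞rest  = begin
      ⟦ first ⟧ ⊞ ⟦ rest ⊕ outer ⟧        ≈⟨ ⊞-cong ≃-refl (⊕≃⊞ rest outer) ⟩
      ⟦ first ⟧ ⊞ (⟦ rest ⟧ ⊞ ⟦ outer ⟧)  ≈⟨ ⊞-assoc _ _ _ ⟨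
      (⟦ first ⟧ ⊞ ⟦ rest ⟧) ⊞ ⟦ outer ⟧  ≈⟨ ⊞-cong first⊞rest ≃-refl ⟩
      ⟦ inner ⟧ ⊞ ⟦ outer ⟧               ≈⟨ inner⊞outer ⟩
      ⟦ G ⟧                               ∎
  }
  where
  open Split s using (inner; outer; inner⊞outer)
  open Decomposition d
  open ≃-Reasoning

decompose : (G : BicolouredGraph m n) → Vertex ⟦ G ⟧ → Decomposition G
decompose G v = go G v (<-wellFounded _)
  where
  go : (G : BicolouredGraph m n) → Vertex ⟦ G ⟧ → Acc _<_ (m + n) → Decomposition G
  go G v (acc rec) with block⊎split G v
  ... | inj₁ β = record { rest = ∅ ; first-block = β ; first⊞rest = ⊞-identityʳ ⟦ G ⟧ ∅ }
    where
    ∅ : BicolouredGraph 0 0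
    ∅ = graph λ ()
  ... | inj₂ s = split⇒decomposition s
    (go (Split.inner s) (Split.inner-vertex s) (rec (inner-smaller s)))

-- Blocks are points and tangles

module _ {_≤_ : Rel A 0ℓ} (≤-trans : Transitive _≤_) (_≤?_ : Decidable _≤_) where

  private
    _≰_ _∥_ : Rel A 0ℓ
    x ≰ y = ¬ (x ≤ y)
    x ∥ y = x ≰ y × y ≰ x

    -- A ∥-step cannot lead from below y to above y, so the path meets a point incomparable to y.
    raise-start : ∀ {x y z} → x ≤ y → z ≰ y → Star _∥_ x z → Star _∥_ y z
    raise-start x≤y z≰y ε = contradiction x≤y z≰y
    raise-start {y = y} x≤y z≰y (_◅_ {j = w} (x≰w , w≰x) path) with w ≤? y | y ≤? w
    ... | yes w≤y | _       = raise-start w≤y z≰y path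
    ... | no  w≰y | no  y≰w = (y≰w , w≰y) ◅ path
    ... | no  w≰y | yes y≤w = contradiction (≤-trans x≤y y≤w) x≰w

    ≰-cycle⇒∥-path : ∀ {x y} → y ≰ x → Star _≰_ x y → Star _∥_ x y
    ≰-cycle⇒∥-path y≰x ε = ε
    ≰-cycle⇒∥-path {x} {y} y≰x (_◅_ {j = w} x≰w path) with x ≤? y
    ... | no  x≰y = (x≰y , y≰x) ◅ ε
    ... | yes x≤y with ≰-cycle⇒∥-path (x≰w ∘ ≤-trans x≤y) path | w ≤? x
    ...   | w∥⋆y | yes w≤x = raise-start w≤x y≰x w∥⋆y
    ...   | w∥⋆y | no  w≰x = (x≰w , w≰x) ◅ w∥⋆y

  ≰-connected⇒∥-connected : Connected _≰_ → Connected _∥_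
  ≰-connected⇒∥-connected con x y = con x y Star.>>= λ {u} {v} u≰v →
    Star.reverse Product.swap (≰-cycle⇒∥-path u≰v (con v u))

separated⇒⊈ : {e f : A → Bool} → ∀ {x} → e x ≡ true → f x ≡ false → ¬ (T ∘ e ⊆ T ∘ f)
separated⇒⊈ ex ¬fx e⊆f = subst T ¬fx (e⊆f (subst T (sym ex) _))

⊆⊎separated : (e f : Fin n → Bool) → T ∘ e ⊆ T ∘ f ⊎ ∃ λ x → e x ≡ true × f x ≡ false
⊆⊎separated e f with Fin.any? (λ x → (e x Bool.≟ true) ×-dec (f x Bool.≟ false))
... | yes separated = inj₂ separated
... | no  none      = inj₁ λ {x} ex → Equivalence.from Bool.T-≡
  (Bool.¬-not λ ¬fx → none (x , Equivalence.to Bool.T-≡ ex , ¬fx))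

⊈⇒separated : {e f : Fin n → Bool} → ¬ (T ∘ e ⊆ T ∘ f) → ∃ λ x → e x ≡ true × f x ≡ false
⊈⇒separated {e = e} {f} e⊈f with ⊆⊎separated e f
... | inj₁ e⊆f       = contradiction (λ {x} → e⊆f {x}) e⊈f
... | inj₂ separated = separated

T-⊆? : (e f : Fin n → Bool) → Dec (T ∘ e ⊆ T ∘ f)
T-⊆? e f with ⊆⊎separated e f
... | inj₁ e⊆f            = yes λ {x} → e⊆f {x}
... | inj₂ (x , ex , ¬fx) = no (separated⇒⊈ ex ¬fx)

⊈-connected⇒incomparable-connected : (N : Fin m → Fin n → Bool) →
  Connected (λ u v → ¬ (T ∘ N u ⊆ T ∘ N v)) → Connected (Incomparable λ u w → T (N u w))
⊈-connected⇒incomparable-connected N = ≰-connected⇒∥-connected {_≤_ = λ u v → T ∘ N u ⊆ T ∘ N v}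
  (λ u⊆v v⊆w {x} e → v⊆w (u⊆v e)) (λ u v → T-⊆? (N u) (N v))

tangle⇒block : {G : BicolouredGraph m n} → IsTangle G → IsBlock ⟦ G ⟧
tangle⇒block {G = G} t@record { 2≤m = s≤s (s≤s _) ; 2≤n = s≤s (s≤s _) } = record
  { vertex = inj₁ zero
  ; strong = λ where
      (inj₁ u) (inj₁ u′) → walk₁ u u′
      (inj₂ w) (inj₂ w′) → walk₂ w w′
      (inj₁ u) (inj₂ w′) → let u₀ , w₀ , a = arc₁₂ in walk₁ u u₀ ◅◅ a ◅ walk₂ w₀ w′
      (inj₂ w) (inj₁ u′) → let w₀ , u₀ , a = arc₂₁ in walk₂ w w₀ ◅◅ a ◅ walk₁ u₀ u′
  }
  where
  walk₁ : ∀ u u′ → Star (Arc ⟦ G ⟧) (inj₁ u) (inj₁ u′)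
  walk₁ u u′ = Star.kleisliStar inj₁ (λ (_ , u′⊈u) →
    let _ , u′w , ¬uw = ⊈⇒separated u′⊈u in nonadjacent ¬uw ◅ adjacent u′w ◅ ε) (con₁ t u u′)
  walk₂ : ∀ w w′ → Star (Arc ⟦ G ⟧) (inj₂ w) (inj₂ w′)
  walk₂ w w′ = Star.kleisliStar inj₂ (λ (w⊈w′ , _) →
    let _ , uw , ¬uw′ = ⊈⇒separated w⊈w′ in adjacent uw ◅ nonadjacent ¬uw′ ◅ ε) (con₂ t w w′)
  arc₁₂ : ∃₂ λ u w → Arc ⟦ G ⟧ (inj₁ u) (inj₂ w)
  arc₁₂ with nonadjacent p ◅ _ ← walk₁ zero (suc zero) = _ , _ , nonadjacent p
  arc₂₁ : ∃₂ λ w u → Arc ⟦ G ⟧ (inj₂ w) (inj₁ u)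
  arc₂₁ with adjacent p ◅ _ ← walk₂ zero (suc zero) = _ , _ , adjacent p

two-classes⇒distinct : StronglyConnected E → V₁ E → V₂ E → ∃₂ λ (u u′ : V₁ E) → u ≢ u′
two-classes⇒distinct con u w
  with nonadjacent {w = w′} ¬uw′ ◅ _ ← con (inj₁ u) (inj₂ w)
  with adjacent {u = u′} u′w′ ◅ _ ← con (inj₂ w′) (inj₁ u) =
  u , u′ , λ { refl → contradiction (trans (sym ¬uw′) u′w′) λ () }

one-class⇒singleton : StronglyConnected E → ¬ V₂ E → (u u′ : V₁ E) → u ≡ u′
one-class⇒singleton con ¬V₂ u u′ with con (inj₁ u) (inj₁ u′)
... | ε                         = refl
... | nonadjacent {w = w} _ ◅ _ = contradiction w ¬V₂

distinct⇒2≤ : {x y : Fin n} → x ≢ y → 2 ≤ n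
distinct⇒2≤ {1}           {zero} {zero} x≢y = contradiction refl x≢y
distinct⇒2≤ {suc (suc n)} x≢y               = s≤s (s≤s z≤n)

block⇒tangle : {G : BicolouredGraph m n} → IsBlock ⟦ G ⟧ → Fin m → Fin n → IsTangle G
block⇒tangle {G = G} β u w = record
  { 2≤m  = let _ , _ , u≢u′ = two-classes⇒distinct (strong β) u w in distinct⇒2≤ u≢u′
  ; 2≤n  = let _ , _ , w≢w′ = two-classes⇒distinct (ᵒ-strong (strong β)) w u in distinct⇒2≤ w≢w′
  ; con₂ = ⊈-connected⇒incomparable-connected (λ w u → edge G u w)
             λ w w′ → ⊈-path₂ (strong β (inj₂ w) (inj₂ w′))
  ; con₁ = ⊈-connected⇒incomparable-connected (edge G)
             λ u u′ → ⊈-path₁ (strong β (inj₁ u′) (inj₁ u))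
  }
  where
  ⊈-path₁ : ∀ {u u′} → Star (Arc ⟦ G ⟧) (inj₁ u) (inj₁ u′) →
            Star (λ u u′ → ¬ (N₁ G u ⊆ N₁ G u′)) u′ u
  ⊈-path₁ ε                                       = ε
  ⊈-path₁ (nonadjacent ¬uw ◅ adjacent u′w ◅ path) = ⊈-path₁ path ◅◅ separated⇒⊈ u′w ¬uw ◅ ε
  ⊈-path₂ : ∀ {w w′} → Star (Arc ⟦ G ⟧) (inj₂ w) (inj₂ w′) →
            Star (λ w w′ → ¬ (N₂ G w ⊆ N₂ G w′)) w w′
  ⊈-path₂ ε                                       = ε
  ⊈-path₂ (adjacent uw ◅ nonadjacent ¬uw′ ◅ path) = separated⇒⊈ uw ¬uw′ ◅ ⊈-path₂ path

data Point : ℕ → ℕ → Set where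
  point₁ : Point 1 0
  point₂ : Point 0 1

point⇒block : (G : BicolouredGraph m n) → Point m n → IsBlock ⟦ G ⟧
point⇒block G point₁ = record { vertex = inj₁ zero ; strong = λ { (inj₁ zero) (inj₁ zero) → ε } }
point⇒block G point₂ = record { vertex = inj₂ zero ; strong = λ { (inj₂ zero) (inj₂ zero) → ε } }

points-≅ : Point m n → (G H : BicolouredGraph m n) → G ≅ H
points-≅ point₁ G H = ≃⇒≅ (mk≃ (↔-id _) (↔-id _) λ _ ())
points-≅ point₂ G H = ≃⇒≅ (mk≃ (↔-id _) (↔-id _) λ ())

point-¬tangle : {G : BicolouredGraph m n} → Point m n → ¬ IsTangle G
point-¬tangle point₁ t with () ← 2≤n t
point-¬tangle point₂ t with () ← 2≤m t

block⇒point⊎tangle : {G : BicolouredGraph m n} → IsBlock ⟦ G ⟧ → Point m n ⊎ IsTangle G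
block⇒point⊎tangle {0} {0} β = contradiction β empty-¬block
block⇒point⊎tangle {1} {0} β = inj₁ point₁
block⇒point⊎tangle {0} {1} β = inj₁ point₂
block⇒point⊎tangle {suc (suc m)} {0} β =
  contradiction (one-class⇒singleton (strong β) (λ ()) zero (suc zero)) λ ()
block⇒point⊎tangle {0} {suc (suc n)} β =
  contradiction (one-class⇒singleton (ᵒ-strong (strong β)) (λ ()) zero (suc zero)) λ ()
block⇒point⊎tangle {suc m} {suc n} β = inj₂ (block⇒tangle β zero zero)

-- Counting isomorphism classes

mkBijection : (S T : Setoid 0ℓ 0ℓ) → let module S = Setoid S ; module T = Setoid T in
              (f : S.Carrier → T.Carrier) → Congruent S._≈_ T._≈_ f → Injective S._≈_ T._≈_ f →
              StrictlySurjective T._≈_ f → Bijection S T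
mkBijection S T f congruent injective surjective = record
  { to        = f
  ; cong      = congruent
  ; bijective = injective , strictlySurjective⇒surjective S T congruent surjective
  }

HasSize-unique : (S : Setoid 0ℓ 0ℓ) → HasSize S k → HasSize S l → k ≡ l
HasSize-unique S f g =
  ↔⇒≡ (Composition.inverse (Bijection⇒Inverse f) (Symmetry.inverse (Bijection⇒Inverse g)))

HasSize-empty : (S : Setoid 0ℓ 0ℓ) → ¬ Setoid.Carrier S → HasSize S 0
HasSize-empty S ¬S = mkBijection (setoid _) S (λ ()) (λ { {()} }) (λ { {()} })
  λ x → contradiction x ¬S

HasSize-singleton : (S : Setoid 0ℓ 0ℓ) → Setoid.Carrier S → (∀ x y → Setoid._≈_ S x y) → HasSize S 1
HasSize-singleton S x all≈ = mkBijection (setoid _) S (λ _ → x) (λ _ → all≈ x x)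
  (λ { {zero} {zero} _ → refl }) λ y → zero , all≈ x y

b-size : ∀ m n → HasSize (graphSetoid m n) (b m n)
b-size m n = proj₂ (countGraphs m n)

τ-size : ∀ m n → HasSize (tangleSetoid m n) (τ m n)
τ-size m n = proj₂ (countTangles m n)

Block : ℕ → ℕ → Set
Block m n = Σ[ G ∈ BicolouredGraph m n ] IsBlock ⟦ G ⟧

blockSetoid : ℕ → ℕ → Setoid 0ℓ 0ℓ
blockSetoid m n = On.setoid {B = Block m n} (graphSetoid m n) proj₁

countPointBlocks : Point m n → HasSize (blockSetoid m n) 1
countPointBlocks {m} {n} p = HasSize-singleton (blockSetoid m n) (G , point⇒block G p)
  λ (G , _) (H , _) → points-≅ p G H
  where
  G : BicolouredGraph m n
  G = graph λ _ _ → false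

countTangleBlocks : ¬ Point m n → HasSize (blockSetoid m n) (τ m n)
countTangleBlocks {m} {n} ¬p = record
  { to        = λ x → let G , t = tangles.to x in G , tangle⇒block t
  ; cong      = tangles.cong
  ; bijective = tangles.injective , λ (G , β) → tangles.surjective (G , isTangle β)
  }
  where
  module tangles = Bijection (τ-size m n)
  isTangle : {G : BicolouredGraph m n} → IsBlock ⟦ G ⟧ → IsTangle G
  isTangle β = Sum.fromInj₂ (λ p → contradiction p ¬p) (block⇒point⊎tangle β)

τ-point : Point m n → τ m n ≡ 0
τ-point {m} {n} p = HasSize-unique (tangleSetoid m n) (τ-size m n)
  (HasSize-empty (tangleSetoid m n) λ (_ , t) → point-¬tangle p t)

countBlocks : ∀ m n → ∃ λ c → HasSize (blockSetoid m n) c × + c ≡ xˢ m n ℤ.+ yˢ m n ℤ.+ Tunl m n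
countBlocks 0 1 = 1 , countPointBlocks point₂ , cong (λ t → 1ℤ ℤ.+ + t) (sym (τ-point point₂))
countBlocks 1 0 = 1 , countPointBlocks point₁ , cong (λ t → 1ℤ ℤ.+ + t) (sym (τ-point point₁))
countBlocks 0 0             = _ , countTangleBlocks (λ ()) , sym (ℤ.+-identityˡ _)
countBlocks 0 (suc (suc n)) = _ , countTangleBlocks (λ ()) , sym (ℤ.+-identityˡ _)
countBlocks 1 (suc n)       = _ , countTangleBlocks (λ ()) , sym (ℤ.+-identityˡ _)
countBlocks (suc (suc m)) n = _ , countTangleBlocks (λ ()) , sym (ℤ.+-identityˡ _)

blockCount : ℕ → ℕ → ℕ
blockCount m n = proj₁ (countBlocks m n)

blockCount-size : ∀ m n → HasSize (blockSetoid m n) (blockCount m n)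
blockCount-size m n = proj₁ (proj₂ (countBlocks m n))

infixl 7 _⊛_

_⊛_ : (ℕ → ℕ → ℕ) → (ℕ → ℕ → ℕ) → ℕ → ℕ → ℕ
(f ⊛ g) i j = sumℕ {suc i} λ k → sumℕ {suc j} λ l → f (toℕ k) (toℕ l) ℕ.* g (i ∸ toℕ k) (j ∸ toℕ l)

sum↔Σ : (f : Fin n → ℕ) → Fin (sumℕ f) ↔ Σ (Fin n) (Fin ∘ f)
sum↔Σ {zero}  f = mk↔ₛ′ (λ ()) (λ ()) (λ ()) (λ ())
sum↔Σ {suc n} f = ⊎↔Σ ↔-∘ ((↔-id _ ⊎-↔ sum↔Σ (f ∘ suc)) ↔-∘ Fin.+↔⊎)
  where
  ⊎↔Σ : {B : Fin (suc n) → Set} → (B zero ⊎ Σ (Fin n) (B ∘ suc)) ↔ Σ (Fin (suc n)) B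
  ⊎↔Σ = mk↔ₛ′
    (λ { (inj₁ x) → zero , x ; (inj₂ (k , x)) → suc k , x })
    (λ { (zero , x) → inj₁ x ; (suc k , x) → inj₂ (k , x) })
    (λ { (zero , x) → refl ; (suc k , x) → refl })
    (λ { (inj₁ x) → refl ; (inj₂ (k , x)) → refl })

ConvolutionIndex : (f g : ℕ → ℕ → ℕ) → ℕ → ℕ → Set
ConvolutionIndex f g i j =
  Σ[ k ∈ Fin (suc i) ] Σ[ l ∈ Fin (suc j) ]
  Fin (f (toℕ k) (toℕ l)) × Fin (g (i ∸ toℕ k) (j ∸ toℕ l))

⊛↔ConvolutionIndex : ∀ f g i j → Fin ((f ⊛ g) i j) ↔ ConvolutionIndex f g i j
⊛↔ConvolutionIndex f g i j = Σ-↔ (↔-id _) (Σ-↔ (↔-id _) Fin.*↔× ↔-∘ sum↔Σ _) ↔-∘ sum↔Σ _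

+≡⇒toℕ-∸ : ∀ k k′ → k + k′ ≡ n → ∃ λ (x : Fin (suc n)) → toℕ x ≡ k × n ∸ toℕ x ≡ k′
+≡⇒toℕ-∸ k k′ refl = fromℕ< k<1+n , Fin.toℕ-fromℕ< k<1+n ,
  trans (cong (k + k′ ∸_) (Fin.toℕ-fromℕ< k<1+n)) (ℕ.m+n∸m≡n k k′)
  where
  k<1+n : k < suc (k + k′)
  k<1+n = s≤s (ℕ.m≤m+n k k′)

toℕ⊎∸↔ : (k : Fin (suc n)) → (Fin (toℕ k) ⊎ Fin (n ∸ toℕ k)) ↔ Fin n
toℕ⊎∸↔ k = Perm.cast-id (ℕ.m+[n∸m]≡n (Fin.toℕ≤pred[n] k)) ↔-∘ ↔-sym Fin.+↔⊎

module _ (i j : ℕ) where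

  FactorPair : Set
  FactorPair = Σ[ k ∈ Fin (suc i) ] Σ[ l ∈ Fin (suc j) ]
               Block (toℕ k) (toℕ l) × BicolouredGraph (i ∸ toℕ k) (j ∸ toℕ l)

  factorPairSetoid : Setoid 0ℓ 0ℓ
  factorPairSetoid = On.setoid {B = FactorPair} (≃-setoid ×ₛ ≃-setoid)
    λ (_ , _ , (G , _) , H) → ⟦ G ⟧ , ⟦ H ⟧

  open Setoid factorPairSetoid using (_≈_)

  assemble : FactorPair → BicolouredGraph i j
  assemble (k , l , (G , _) , H) = relabel (⟦ G ⟧ ⊞ ⟦ H ⟧) (toℕ⊎∸↔ k) (toℕ⊎∸↔ l)

  assemble≃⊞ : (x@(_ , _ , (G , _) , H) : FactorPair) → ⟦ assemble x ⟧ ≃ ⟦ G ⟧ ⊞ ⟦ H ⟧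
  assemble≃⊞ (k , l , _) = relabel-≃ (toℕ⊎∸↔ k) (toℕ⊎∸↔ l)

  assemble-cong : ∀ {x y} → x ≈ y → assemble x ≅ assemble y
  assemble-cong {x@(_ , _ , (G , _) , H)} {y@(_ , _ , (G′ , _) , H′)} (G≃G′ , H≃H′) = ≃⇒≅ (begin
    ⟦ assemble x ⟧     ≈⟨ assemble≃⊞ x ⟩
    ⟦ G ⟧ ⊞ ⟦ H ⟧      ≈⟨ ⊞-cong G≃G′ H≃H′ ⟩
    ⟦ G′ ⟧ ⊞ ⟦ H′ ⟧    ≈⟨ assemble≃⊞ y ⟨
    ⟦ assemble y ⟧     ∎)
    where open ≃-Reasoning

  assemble-injective : ∀ {x y} → assemble x ≅ assemble y → x ≈ y
  assemble-injective {x@(_ , _ , (G , β) , H)} {y@(_ , _ , (G′ , β′) , H′)} e = ⊞-cancel β β′ (begin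
    ⟦ G ⟧ ⊞ ⟦ H ⟧      ≈⟨ assemble≃⊞ x ⟨
    ⟦ assemble x ⟧     ≈⟨ ≅⇒≃ e ⟩
    ⟦ assemble y ⟧     ≈⟨ assemble≃⊞ y ⟩
    ⟦ G′ ⟧ ⊞ ⟦ H′ ⟧    ∎)
    where open ≃-Reasoning

  ⊞⇒assembled : ∀ {k k′ l l′} → k + k′ ≡ i → l + l′ ≡ j →
                {G : BicolouredGraph k l} {H : BicolouredGraph k′ l′} → IsBlock ⟦ G ⟧ →
                ∃ λ x → ⟦ assemble x ⟧ ≃ ⟦ G ⟧ ⊞ ⟦ H ⟧
  ⊞⇒assembled {k} {k′} {l} {l′} p q {G} {H} β with +≡⇒toℕ-∸ k k′ p | +≡⇒toℕ-∸ l l′ q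
  ... | k , refl , refl | l , refl , refl = x , assemble≃⊞ x
    where
    x : FactorPair
    x = k , l , (G , β) , H

  assemble-surjective : Fin i ⊎ Fin j → ∀ G → ∃ λ x → assemble x ≅ G
  assemble-surjective v G =
    let open Decomposition (decompose G v)
        x , x≃⊞ = ⊞⇒assembled (⊎↔⇒+≡ (iso₁ first⊞rest)) (⊎↔⇒+≡ (iso₂ first⊞rest)) first-block
    in  x , ≃⇒≅ (≃-trans x≃⊞ first⊞rest)

  uniqueFactorisation : Fin i ⊎ Fin j → Bijection factorPairSetoid (graphSetoid i j)
  uniqueFactorisation v = mkBijection factorPairSetoid (graphSetoid i j) assemble
    (λ {x} {y} → assemble-cong {x} {y}) (λ {x} {y} → assemble-injective {x} {y})
    (assemble-surjective v)

  countFactorPairs : HasSize factorPairSetoid ((blockCount ⊛ b) i j)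
  countFactorPairs = Composition.bijection (Inverse⇒Bijection (⊛↔ConvolutionIndex blockCount b i j))
    (mkBijection (setoid _) factorPairSetoid pair pair-cong pair-injective pair-surjective)
    where
    blocks : ∀ k l → HasSize (blockSetoid (toℕ k) (toℕ l)) (blockCount (toℕ k) (toℕ l))
    blocks k l = blockCount-size (toℕ k) (toℕ l)
    graphs : ∀ k l → HasSize (graphSetoid (i ∸ toℕ k) (j ∸ toℕ l)) (b (i ∸ toℕ k) (j ∸ toℕ l))
    graphs k l = b-size (i ∸ toℕ k) (j ∸ toℕ l)
    pair : ConvolutionIndex blockCount b i j → FactorPair
    pair (k , l , p , q) = k , l , Bijection.to (blocks k l) p , Bijection.to (graphs k l) q
    pair-cong : ∀ {x y} → x ≡ y → pair x ≈ pair y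
    pair-cong {x} refl = Setoid.refl factorPairSetoid {pair x}
    pair-injective : ∀ {x y} → pair x ≈ pair y → x ≡ y
    pair-injective {k , l , _} {k′ , l′ , _} (G≃G′ , H≃H′)
      with Fin.toℕ-injective {i = k} {k′} (↔⇒≡ (iso₁ G≃G′))
         | Fin.toℕ-injective {i = l} {l′} (↔⇒≡ (iso₂ G≃G′))
    ... | refl | refl = cong₂ (λ p q → k , l , p , q)
      (Bijection.injective (blocks k l) (≃⇒≅ G≃G′))
      (Bijection.injective (graphs k l) (≃⇒≅ H≃H′))
    pair-surjective : ∀ y → ∃ λ x → pair x ≈ y
    pair-surjective (k , l , B , H) =
      let p , p≅B = Bijection.strictlySurjective (blocks k l) B
          q , q≅H = Bijection.strictlySurjective (graphs k l) H
      in  (k , l , p , q) , ≅⇒≃ p≅B , ≅⇒≃ q≅H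

  b≡blockCount⊛b : Fin i ⊎ Fin j → b i j ≡ (blockCount ⊛ b) i j
  b≡blockCount⊛b v = HasSize-unique (graphSetoid i j) (b-size i j)
    (Composition.bijection countFactorPairs (uniqueFactorisation v))

b[0,0]≡1 : b 0 0 ≡ 1
b[0,0]≡1 = HasSize-unique (graphSetoid 0 0) (b-size 0 0)
  (HasSize-singleton (graphSetoid 0 0) (graph λ ()) λ _ _ → ≃⇒≅ (mk≃ (↔-id _) (↔-id _) λ ()))

blockCount[0,0]≡0 : blockCount 0 0 ≡ 0
blockCount[0,0]≡0 = HasSize-unique (blockSetoid 0 0) (blockCount-size 0 0)
  (HasSize-empty (blockSetoid 0 0) λ (_ , β) → empty-¬block β)

-- Power series

infixl 6 _+ˢ_

_+ˢ_ : Series → Series → Series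
(F +ˢ G) i j = F i j ℤ.+ G i j

∑∑-cong : {f g : Fin m → Fin n → ℤ} → (∀ k l → f k l ≡ g k l) →
          ∑[ k < m ] ∑[ l < n ] f k l ≡ ∑[ k < m ] ∑[ l < n ] g k l
∑∑-cong f≗g = sum-cong-≗ λ k → sum-cong-≗ (f≗g k)

pos-sum : (f : Fin n → ℕ) → + sumℕ f ≡ sum (λ k → + f k)
pos-sum {zero}  f = refl
pos-sum {suc n} f = cong (ℤ._+_ (+ f zero)) (pos-sum (f ∘ suc))

pos-⊛ : ∀ f g → (λ i j → + (f ⊛ g) i j) ≈ˢ (λ i j → + f i j) *ˢ (λ i j → + g i j)
pos-⊛ f g i j = begin
  + (f ⊛ g) i j
    ≡⟨ pos-sum {suc i} (λ k → sumℕ {suc j} (term k)) ⟩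
  ∑[ k ≤ i ] (+ sumℕ {suc j} (term k))
    ≡⟨ sum-cong-≗ {suc i} (λ k → pos-sum {suc j} (term k)) ⟩
  ∑[ k ≤ i ] ∑[ l ≤ j ] (+ term k l)
    ≡⟨ ∑∑-cong {suc i} {suc j} (λ k l → ℤ.pos-* (f (toℕ k) (toℕ l)) (g (i ∸ toℕ k) (j ∸ toℕ l))) ⟩
  ∑[ k ≤ i ] ∑[ l ≤ j ] (+ f (toℕ k) (toℕ l) ℤ.* + g (i ∸ toℕ k) (j ∸ toℕ l)) ∎
  where
  open ≡-Reasoning
  term : Fin (suc i) → Fin (suc j) → ℕ
  term k l = f (toℕ k) (toℕ l) ℕ.* g (i ∸ toℕ k) (j ∸ toℕ l)

∑-reverse : ∀ n (f : ℕ → ℕ → ℤ) →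
            ∑[ k ≤ n ] f (toℕ k) (n ∸ toℕ k) ≡ ∑[ k ≤ n ] f (n ∸ toℕ k) (toℕ k)
∑-reverse n f = trans (sum-permute {suc n} (λ k → f (toℕ k) (n ∸ toℕ k)) Perm.reverse)
  (sum-cong-≗ {suc n} λ k → cong₂ f (Fin.opposite-prop k)
    (trans (cong (n ∸_) (Fin.opposite-prop k)) (ℕ.m∸[m∸n]≡n (Fin.toℕ≤pred[n] k))))

*ˢ-comm : ∀ F G → F *ˢ G ≈ˢ G *ˢ F
*ˢ-comm F G i j = begin
  ∑[ k ≤ i ] ∑[ l ≤ j ] (F (toℕ k) (toℕ l) ℤ.* G (i ∸ toℕ k) (j ∸ toℕ l))
    ≡⟨ ∑-reverse i (λ k k′ → ∑[ l ≤ j ] (F k (toℕ l) ℤ.* G k′ (j ∸ toℕ l))) ⟩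
  ∑[ k ≤ i ] ∑[ l ≤ j ] (F (i ∸ toℕ k) (toℕ l) ℤ.* G (toℕ k) (j ∸ toℕ l))
    ≡⟨ sum-cong-≗ {suc i} (λ k → ∑-reverse j λ l l′ → F (i ∸ toℕ k) l ℤ.* G (toℕ k) l′) ⟩
  ∑[ k ≤ i ] ∑[ l ≤ j ] (F (i ∸ toℕ k) (j ∸ toℕ l) ℤ.* G (toℕ k) (toℕ l))
    ≡⟨ ∑∑-cong {suc i} {suc j} (λ k l → ℤ.*-comm (F (i ∸ toℕ k) (j ∸ toℕ l)) (G (toℕ k) (toℕ l))) ⟩
  ∑[ k ≤ i ] ∑[ l ≤ j ] (G (toℕ k) (toℕ l) ℤ.* F (i ∸ toℕ k) (j ∸ toℕ l)) ∎
  where open ≡-Reasoning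

*ˢ-identityˡ : ∀ F → 1ˢ *ˢ F ≈ˢ F
*ˢ-identityˡ F i j = begin
  (1ℤ ℤ.* F i j ℤ.+ sum {j} (λ l → 0ℤ)) ℤ.+ sum {i} (λ k → 0ℤ ℤ.+ sum {j} (λ l → 0ℤ))
    ≡⟨ cong₂ ℤ._+_ (cong₂ ℤ._+_ (ℤ.*-identityˡ (F i j)) (sum-replicate-zero j))
         (trans (sum-cong-≗ {i} λ _ → trans (ℤ.+-identityˡ _) (sum-replicate-zero j))
           (sum-replicate-zero i)) ⟩
  (F i j ℤ.+ 0ℤ) ℤ.+ 0ℤ ≡⟨ trans (ℤ.+-identityʳ _) (ℤ.+-identityʳ _) ⟩
  F i j ∎
  where open ≡-Reasoning

*ˢ-congʳ : ∀ {F G} H → F ≈ˢ G → F *ˢ H ≈ˢ G *ˢ H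
*ˢ-congʳ H F≈G i j = ∑∑-cong {suc i} {suc j} λ k l →
  cong (ℤ._* H (i ∸ toℕ k) (j ∸ toℕ l)) (F≈G (toℕ k) (toℕ l))

*ˢ-distribʳ-+ˢ : ∀ H F G → (F +ˢ G) *ˢ H ≈ˢ F *ˢ H +ˢ G *ˢ H
*ˢ-distribʳ-+ˢ H F G i j = begin
  ((F +ˢ G) *ˢ H) i j
    ≡⟨ ∑∑-cong {suc i} {suc j} (λ k l → ℤ.*-distribʳ-+
         (H (i ∸ toℕ k) (j ∸ toℕ l)) (F (toℕ k) (toℕ l)) (G (toℕ k) (toℕ l))) ⟩
  ∑[ k ≤ i ] ∑[ l ≤ j ] (term F k l ℤ.+ term G k l)
    ≡⟨ sum-cong-≗ {suc i} (λ k → ∑-distrib-+ {suc j} (term F k) (term G k)) ⟩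
  ∑[ k ≤ i ] ((∑[ l ≤ j ] term F k l) ℤ.+ (∑[ l ≤ j ] term G k l))
    ≡⟨ ∑-distrib-+ {suc i} (λ k → ∑[ l ≤ j ] term F k l) (λ k → ∑[ l ≤ j ] term G k l) ⟩
  (F *ˢ H +ˢ G *ˢ H) i j ∎
  where
  open ≡-Reasoning
  term : Series → Fin (suc i) → Fin (suc j) → ℤ
  term F k l = F (toℕ k) (toℕ l) ℤ.* H (i ∸ toℕ k) (j ∸ toℕ l)

fixpoint⇒inverseˡ : ∀ F G → F ≈ˢ 1ˢ +ˢ G *ˢ F → (1ˢ -ˢ G) *ˢ F ≈ˢ 1ˢ
fixpoint⇒inverseˡ F G F≈1+GF i j = ∙-cancelʳ ℤ.+-0-abelianGroup ((G *ˢ F) i j) _ _ (begin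
  ((1ˢ -ˢ G) *ˢ F +ˢ G *ˢ F) i j  ≡⟨ *ˢ-distribʳ-+ˢ F (1ˢ -ˢ G) G i j ⟨
  ((1ˢ -ˢ G +ˢ G) *ˢ F) i j       ≡⟨ *ˢ-congʳ F (λ k l → x-y+y≡x (1ˢ k l) (G k l)) i j ⟩
  (1ˢ *ˢ F) i j                   ≡⟨ *ˢ-identityˡ F i j ⟩
  F i j                           ≡⟨ F≈1+GF i j ⟩
  (1ˢ +ˢ G *ˢ F) i j              ∎)
  where
  open ≡-Reasoning
  x-y+y≡x : ∀ x y → x ℤ.- y ℤ.+ y ≡ x
  x-y+y≡x = solve-∀

Blocks : Series
Blocks i j = + blockCount i j

Blocks≈x+y+Tunl : Blocks ≈ˢ xˢ +ˢ yˢ +ˢ Tunl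
Blocks≈x+y+Tunl i j = proj₂ (proj₂ (countBlocks i j))

Bunl≈1+Blocks*Bunl : Bunl ≈ˢ 1ˢ +ˢ Blocks *ˢ Bunl
Bunl≈1+Blocks*Bunl 0 0 = begin
  + b 0 0
    ≡⟨ cong +_ b[0,0]≡1 ⟩
  1ℤ ℤ.+ (0ℤ ℤ.* Bunl 0 0 ℤ.+ 0ℤ ℤ.+ 0ℤ)
    ≡⟨ cong (λ c → 1ℤ ℤ.+ (+ c ℤ.* Bunl 0 0 ℤ.+ 0ℤ ℤ.+ 0ℤ)) blockCount[0,0]≡0 ⟨
  (1ˢ +ˢ Blocks *ˢ Bunl) 0 0 ∎
  where open ≡-Reasoning
Bunl≈1+Blocks*Bunl 0 (suc j) = trans (cong +_ (b≡blockCount⊛b 0 (suc j) (inj₂ zero)))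
  (trans (pos-⊛ blockCount b 0 (suc j)) (sym (ℤ.+-identityˡ _)))
Bunl≈1+Blocks*Bunl (suc i) j = trans (cong +_ (b≡blockCount⊛b (suc i) j (inj₁ zero)))
  (trans (pos-⊛ blockCount b (suc i) j) (sym (ℤ.+-identityˡ _)))

theorem4p2 : Σ[ (Bunl⁻¹ , _) ∈ Invertible 1ˢ _*ˢ_ Bunl ] Tunl ≈ˢ 1ˢ -ˢ xˢ -ˢ yˢ -ˢ Bunl⁻¹
theorem4p2 = (1ˢ -ˢ Blocks , inverseˡ , inverseʳ) , λ i j → begin
  Tunl i j
    ≡⟨ t≡o-x-y-[o-[x+y+t]] (1ˢ i j) (xˢ i j) (yˢ i j) (Tunl i j) ⟩
  (1ˢ -ˢ xˢ -ˢ yˢ -ˢ (1ˢ -ˢ (xˢ +ˢ yˢ +ˢ Tunl))) i j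
    ≡⟨ cong (λ t → (1ˢ -ˢ xˢ -ˢ yˢ) i j ℤ.- (1ˢ i j ℤ.- t)) (Blocks≈x+y+Tunl i j) ⟨
  (1ˢ -ˢ xˢ -ˢ yˢ -ˢ (1ˢ -ˢ Blocks)) i j ∎
  where
  open ≡-Reasoning
  inverseˡ : (1ˢ -ˢ Blocks) *ˢ Bunl ≈ˢ 1ˢ
  inverseˡ = fixpoint⇒inverseˡ Bunl Blocks Bunl≈1+Blocks*Bunl
  inverseʳ : Bunl *ˢ (1ˢ -ˢ Blocks) ≈ˢ 1ˢ
  inverseʳ i j = trans (*ˢ-comm Bunl (1ˢ -ˢ Blocks) i j) (inverseˡ i j)
  t≡o-x-y-[o-[x+y+t]] : ∀ o x y t → t ≡ o ℤ.- x ℤ.- y ℤ.- (o ℤ.- (x ℤ.+ y ℤ.+ t))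
  t≡o-x-y-[o-[x+y+t]] = solve-∀
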